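{- Let $D=(Q,\Sigma,\delta,q_0,A)$ and $D'=(Q',\Sigma,\delta',q_0',A')$ be minimized DFAs over the same alphabet with $L(D)\sim L(D')$. Then $D\cong_I D'$.
   Context: All DFAs are complete (total transition function $\delta$, extended to words in the usual way) and all their states are reachable from the start state. A DFA is \emph{minimized} if it is the minimal DFA for its language, i.e. all states are reachable and no two distinct states are equivalent (no two distinct states $p\neq q$ satisfy $L(p)=L(q)$, where $L(q)$ is the language accepted when $q$ is used as start state). Two languages $L,L'$ are \emph{finitely different}, written $L\sim L'$, if the symmetric difference $L\triangle L'$ is finite. The \emph{infinite part} $I(D)$ of a DFA $D$ is the set of states $q\in Q$ such that $\{w\in\Sigma^*:\delta(q_0,w)=q\}$ is infinite (equivalently: $q$ lies on a cycle, i.e. $\delta(q,w)=q$ for some nonempty $w$, or is reachable from a state on a cycle); the \emph{finite part} is $F(D)=Q\setminus I(D)$. We write $D\cong_I D'$ (isomorphic infinite parts) if there is a bijection $f:I(D)\to I(D')$ such that (1) for all $q\in I(D)$, $q\in A\iff f(q)\in A'$, and (2) for all $q\in I(D)$ and $c\in\Sigma$, $f(\delta(q,c))=\delta'(f(q),c)$. -}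

module Defs where

open import Data.Fin using (Fin)
open import Data.Irrelevant as Irrelevant using ()
open import Data.List using (List; []; [_]; _∷ʳ_; drop; foldl; map; reverse)
open import Data.List.Membership.Propositional using (_∈_)
open import Data.List.Membership.Propositional.Properties using (∈-map⁺)
open import Data.List.Properties using (foldl-∷ʳ; reverse-++; reverse-involutive)
open import Data.Nat using (ℕ)
open import Data.Product using (∃; _×_; _,_)
open import Data.Refinement using (Refinement; _,_; value)
open import Function using (_∘_; _↔_; _⇔_; _⤖_; Bijection)
open import Level using (0ℓ)
open import Relation.Binary.PropositionalEquality
  using (_≡_; _≢_; refl; sym; trans; cong; subst)
open import Relation.Nullary using (¬_)
open import Relation.Unary using (Pred; Decidable; _∪_; _∖_; _≐_; _⊆_)

FiniteType : Set → Set
FiniteType X = ∃ λ (n : ℕ) → X ↔ Fin n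

-- The list may contain elements outside P: for decidable P (the only use
-- below) covering P by a list and listing P exactly are equivalent.
Finite : {X : Set} → Pred X 0ℓ → Set
Finite {X} P = ∃ λ (xs : List X) → P ⊆ (_∈ xs)

Infinite : {X : Set} → Pred X 0ℓ → Set
Infinite P = ¬ Finite P

Language : Set → Set₁
Language Σ = Pred (List Σ) 0ℓ

_△_ : {Σ : Set} → Language Σ → Language Σ → Language Σ
L △ L′ = (L ∖ L′) ∪ (L′ ∖ L)

_∼_ : {Σ : Set} → Language Σ → Language Σ → Set
L ∼ L′ = Finite (L △ L′)

record DFA (Σ : Set) : Set₁ where
  field
    State      : Set
    finite     : FiniteType State
    δ          : State → Σ → State
    start      : State
    Accepting  : Pred State 0ℓ
    accepting? : Decidable Accepting

  δ* : State → List Σ → State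
  δ* = foldl δ

  languageFrom : State → Language Σ
  languageFrom q w = Accepting (δ* q w)

  language : Language Σ
  language = languageFrom start

  Reaching : State → Language Σ
  Reaching q w = δ* start w ≡ q

  record Minimized : Set where
    field
      reachable    : ∀ q → ∃ (Reaching q)
      inequivalent : ∀ {p q} → p ≢ q → ¬ (languageFrom p ≐ languageFrom q)

  InInfinitePart : Pred State 0ℓ
  InInfinitePart q = Infinite (Reaching q)

  -- Membership proofs are irrelevant, so elements of the infinite part are
  -- equal as soon as the underlying states are.
  InfinitePart : Set
  InfinitePart = Refinement State InInfinitePart

  δ-infinite : ∀ {q} c → InInfinitePart q → InInfinitePart (δ q c)
  δ-infinite {q} c inf (ws , covers) = inf (map dropLast ws , covers′)
    where
    dropLast : List Σ → List Σ
    dropLast = reverse ∘ drop 1 ∘ reverse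

    dropLast-∷ʳ : ∀ w → dropLast (w ∷ʳ c) ≡ w
    dropLast-∷ʳ w = trans (cong (reverse ∘ drop 1) (reverse-++ w [ c ]))
                          (reverse-involutive w)

    covers′ : Reaching q ⊆ (_∈ map dropLast ws)
    covers′ {w} w↝q = subst (_∈ map dropLast ws) (dropLast-∷ʳ w)
      (∈-map⁺ dropLast
        (covers {w ∷ʳ c} (trans (foldl-∷ʳ δ start c w) (cong (λ p → δ p c) w↝q))))

  δᴵ : InfinitePart → Σ → InfinitePart
  δᴵ (q , inf) c = δ q c , Irrelevant.map (δ-infinite c) inf

record _≅ᴵ_ {Σ : Set} (D D′ : DFA Σ) : Set where
  private
    module D  = DFA D
    module D′ = DFA D′
  field
    bijection : D.InfinitePart ⤖ D′.InfinitePart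

  f : D.InfinitePart → D′.InfinitePart
  f = Bijection.to bijection

  field
    preserves-accepting : ∀ q → D.Accepting (value q) ⇔ D′.Accepting (value (f q))
    preserves-δ         : ∀ q c → f (D.δᴵ q c) ≡ D′.δᴵ (f q) c

{-# OPTIONS --safe #-}

-- If w is longer than every word in the symmetric difference, then w leads D
-- and D′ to states accepting the same language. A state of the infinite part
-- is reached by such long words, so it has an equivalent state in D′, which is
-- unique since D′ is minimized. All long words reaching the first state reach
-- the second one, so the latter is again in the infinite part. The resulting
-- relation is symmetric in D and D′, hence a bijection.
--
-- Constructively, a long word has to be computed for a state whose membership
-- in the infinite part is only known irrelevantly: the search is bounded,
-- since the part of a word after its first N letters can be shortened to at
-- most as many letters as there are states.

module Submission where

open import Defs

open import Data.Fin using (Fin; toℕ)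
open import Data.Fin.Properties using (inj⇒≟; pigeonhole; toℕ≤pred[n])
open import Data.Irrelevant using ([_])
open import Data.List
  using (List; []; _∷_; _++_; allFin; cartesianProductWith; drop; foldl; length; map; take)
open import Data.List.Extrema.Nat using (argmax; f[xs]≤f[argmax])
open import Data.List.Membership.Propositional using (_∈_; lose)
open import Data.List.Membership.Propositional.Properties
  using (∈-++⁺ˡ; ∈-++⁺ʳ; ∈-allFin; ∈-cartesianProductWith⁺; ∈-map⁺)
open import Data.List.Properties
  using (foldl-++; length-++; length-drop; length-take; take++drop≡id)
open import Data.List.Relation.Unary.All as All using ()
open import Data.List.Relation.Unary.Any using (any?; here; there; satisfied)
open import Data.Nat using (ℕ; zero; suc; _+_; _∸_; _≤_; _<_; s≤s; _≤?_)
open import Data.Nat.Induction using (<-wellFounded)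
open import Data.Nat.Properties
open import Data.Product using (∃; _×_; _,_; proj₁; proj₂)
open import Data.Refinement using (_,_; value; value-injective)
open import Data.Sum using (inj₁; inj₂)
open import Function using (_⇔_; _↔_; mk⇔; mk⤖; Equivalence; Injection; Inverse)
open import Function.Consequences.Propositional using (strictlySurjective⇒surjective)
open import Function.Construct.Symmetry using (⇔-sym)
open import Function.Properties.Inverse using (↔⇒↣)
open import Induction.WellFounded using (Acc; acc)
open import Relation.Binary using (DecidableEquality)
open import Relation.Binary.PropositionalEquality
  using (_≡_; refl; sym; trans; cong; subst; module ≡-Reasoning)
open import Relation.Nullary using (Dec; yes; no; contradiction; contradiction-irr)
open import Relation.Nullary.Decidable using (decidable-stable; _×-dec_)
open import Relation.Unary using (_≐_)

private
  variable
    A S Σ : Set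

finite⇒≟ : FiniteType A → DecidableEquality A
finite⇒≟ (_ , A↔Fin) = inj⇒≟ (↔⇒↣ A↔Fin)

enumerate : FiniteType A → List A
enumerate (n , A↔Fin) = map (Inverse.from A↔Fin) (allFin n)

∈-enumerate : (fin : FiniteType A) (x : A) → x ∈ enumerate fin
∈-enumerate (n , A↔Fin) x =
  subst (_∈ _) (Inverse.strictlyInverseʳ A↔Fin x)
    (∈-map⁺ (Inverse.from A↔Fin) (∈-allFin (Inverse.to A↔Fin x)))

wordsUpTo : FiniteType Σ → ℕ → List (List Σ)
wordsUpTo fin zero    = [] ∷ []
wordsUpTo fin (suc k) = [] ∷ cartesianProductWith _∷_ (enumerate fin) (wordsUpTo fin k)

∈-wordsUpTo : (fin : FiniteType Σ) {k : ℕ} (w : List Σ) → length w ≤ k → w ∈ wordsUpTo fin k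
∈-wordsUpTo fin {zero}  []      _         = here refl
∈-wordsUpTo fin {suc k} []      _         = here refl
∈-wordsUpTo fin {suc k} (c ∷ w) (s≤s w≤k) =
  there (∈-cartesianProductWith⁺ _∷_ (∈-enumerate fin c) (∈-wordsUpTo fin w w≤k))

finite⇒bounded : {P : Language Σ} → Finite P → ∃ λ N → ∀ {w} → P w → length w < N
finite⇒bounded (ws , covers) =
  suc (length (argmax length [] ws)) ,
  λ Pw → s≤s (All.lookup (f[xs]≤f[argmax] [] ws) (covers Pw))

cut-length : ∀ {i j} (w : List A) → i < j → j ≤ length w →
             length (take i w ++ drop j w) < length w
cut-length {i = i} {j} w i<j j≤w = begin-strict
  length (take i w ++ drop j w)         ≡⟨ length-++ (take i w) ⟩
  length (take i w) + length (drop j w) ≡⟨ cong (length (take i w) +_) (length-drop j w) ⟩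
  length (take i w) + (length w ∸ j)    ≤⟨ +-monoˡ-≤ _ take≤i ⟩
  i + (length w ∸ j)                    <⟨ +-monoˡ-< _ i<j ⟩
  j + (length w ∸ j)                    ≡⟨ m+[n∸m]≡n j≤w ⟩
  length w                              ∎
  where
  open ≤-Reasoning
  take≤i : length (take i w) ≤ i
  take≤i = ≤-trans (≤-reflexive (length-take i w)) (m⊓n≤m i (length w))

-- The letters between positions `i` and `j` trace a loop of the run.
foldl-cut : ∀ (δ : S → A → S) p i j w → foldl δ p (take i w) ≡ foldl δ p (take j w) →
            foldl δ p (take i w ++ drop j w) ≡ foldl δ p w
foldl-cut δ p i j w eq = begin
  foldl δ p (take i w ++ drop j w)          ≡⟨ foldl-++ δ p (take i w) (drop j w) ⟩
  foldl δ (foldl δ p (take i w)) (drop j w) ≡⟨ cong (λ q → foldl δ q (drop j w)) eq ⟩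
  foldl δ (foldl δ p (take j w)) (drop j w) ≡⟨ foldl-++ δ p (take j w) (drop j w) ⟨
  foldl δ p (take j w ++ drop j w)          ≡⟨ cong (foldl δ p) (take++drop≡id j w) ⟩
  foldl δ p w                               ∎
  where open ≡-Reasoning

-- A run on more than `n` letters repeats a state; excising the loop strictly shortens the word, so
-- the recursion on length terminates.
shorten : ∀ {n} → S ↔ Fin n → (δ : S → A → S) (p : S) (w : List A) →
          ∃ λ v → length v ≤ n × foldl δ p v ≡ foldl δ p w
shorten {S = S} {A = A} {n = n} S↔Fin δ p w = go w (<-wellFounded (length w))
  where
  go : (w : List A) → Acc _<_ (length w) → ∃ λ v → length v ≤ n × foldl δ p v ≡ foldl δ p w
  go w (acc rec) with length w ≤? n
  ... | yes w≤n = w , w≤n , refl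
  ... | no  w≰n =
    -- The prefixes of lengths 0 to `n` are one more than the states.
    let visited = λ (i : Fin (suc n)) → foldl δ p (take (toℕ i) w)
        i , j , i<j , same = pigeonhole ≤-refl (λ i → Inverse.to S↔Fin (visited i))
        j≤w = ≤-trans (toℕ≤pred[n] j) (<⇒≤ (≰⇒> w≰n))
        v , v≤n , v≡ = go (take (toℕ i) w ++ drop (toℕ j) w) (rec (cut-length w i<j j≤w))
    in v , v≤n , trans v≡ (foldl-cut δ p (toℕ i) (toℕ j) w (Injection.injective (↔⇒↣ S↔Fin) same))

module _ (finΣ : FiniteType Σ) (D : DFA Σ) where
  open DFA D

  LongWordTo : ℕ → State → Language Σ
  LongWordTo N q w = N ≤ length w × Reaching q w

  -- Keeping the first `N` letters keeps a word long, and `shorten` bounds the rest by the number of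
  -- states, so finitely many candidates suffice.
  longWordTo? : ∀ N q → Dec (∃ (LongWordTo N q))
  longWordTo? N q
    with any? (λ w → N ≤? length w ×-dec finite⇒≟ finite (δ* start w) q)
              (wordsUpTo finΣ (N + proj₁ finite))
  ... | yes found = yes (satisfied found)
  ... | no ¬found = no λ (w , N≤w , w↝q) →
    let u            = take N w
        |u|≡N        = trans (length-take N w) (m≤n⇒m⊓n≡m N≤w)
        v , v≤n , v≡ = shorten (proj₂ finite) δ (δ* start u) (drop N w)
        |uv|≡        = trans (length-++ u) (cong (_+ length v) |u|≡N)
        uv↝q         = begin
          δ* start (u ++ v)            ≡⟨ foldl-++ δ start u v ⟩
          δ* (δ* start u) v            ≡⟨ v≡ ⟩
          δ* (δ* start u) (drop N w)   ≡⟨ foldl-++ δ start u (drop N w) ⟨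
          δ* start (u ++ drop N w)     ≡⟨ cong (δ* start) (take++drop≡id N w) ⟩
          δ* start w                   ≡⟨ w↝q ⟩
          q                            ∎
    in ¬found (lose
         (∈-wordsUpTo finΣ (u ++ v) (≤-trans (≤-reflexive |uv|≡) (+-monoʳ-≤ N v≤n)))
         (≤-trans (m≤m+n N _) (≤-reflexive (sym |uv|≡)) , uv↝q))
    where open ≡-Reasoning

  -- Over a finite alphabet, only finitely many words have length at most `N`.
  finite-if-long : ∀ N {q} → Finite (LongWordTo N q) → Finite (Reaching q)
  finite-if-long N {q} (ws , covers) = ws ++ wordsUpTo finΣ N , covers′
    where
    covers′ : ∀ {w} → Reaching q w → w ∈ ws ++ wordsUpTo finΣ N
    covers′ {w} w↝q with ≤-total N (length w)
    ... | inj₁ N≤w = ∈-++⁺ˡ (covers (N≤w , w↝q))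
    ... | inj₂ w≤N = ∈-++⁺ʳ ws (∈-wordsUpTo finΣ w w≤N)

  longWordTo : ∀ N {q} → .(InInfinitePart q) → ∃ (LongWordTo N q)
  longWordTo N {q} inf with longWordTo? N q
  ... | yes found = found
  -- The irrelevant `inf` only refutes this case: without long words, the empty list covers them.
  ... | no ¬found = contradiction-irr inf λ ¬fin →
    ¬fin (finite-if-long N ([] , λ {w} long → contradiction (w , long) ¬found))

AgreeFrom : ℕ → DFA Σ → DFA Σ → Set
AgreeFrom N D D′ = ∀ w → N ≤ length w → DFA.language D w ⇔ DFA.language D′ w

agree-sym : ∀ {N} (D D′ : DFA Σ) → AgreeFrom N D D′ → AgreeFrom N D′ D
agree-sym D D′ agree w N≤w = ⇔-sym (agree w N≤w)

∼⇒agree : (D D′ : DFA Σ) → DFA.language D ∼ DFA.language D′ → ∃ λ N → AgreeFrom N D D′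
∼⇒agree D D′ L∼L′ with finite⇒bounded L∼L′
... | N , bound = N , λ w N≤w → mk⇔
  -- A disagreement on `w` would put it in the symmetric difference; decidable acceptance removes
  -- the double negation.
  (λ Lw  → decidable-stable (D′.accepting? _) λ ¬L′w → <⇒≱ (bound {w} (inj₁ (Lw , ¬L′w))) N≤w)
  (λ L′w → decidable-stable (D.accepting? _) λ ¬Lw → <⇒≱ (bound {w} (inj₂ (L′w , ¬Lw))) N≤w)
  where
  module D  = DFA D
  module D′ = DFA D′

Equivalent : (D D′ : DFA Σ) → DFA.State D → DFA.State D′ → Set
Equivalent D D′ q q′ = DFA.languageFrom D q ≐ DFA.languageFrom D′ q′

equivalent-sym : (D D′ : DFA Σ) → ∀ {q q′} → Equivalent D D′ q q′ → Equivalent D′ D q′ q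
equivalent-sym D D′ (to , from) = (λ {w} → from {w}) , (λ {w} → to {w})

-- Minimality only refutes `q′ ≢ q″`; decidable equality of states then gives equality.
equivalent-unique : (D D′ : DFA Σ) → DFA.Minimized D′ → ∀ {q q′ q″} →
                    Equivalent D D′ q q′ → Equivalent D D′ q q″ → q′ ≡ q″
equivalent-unique D D′ min′ (to₁ , from₁) (to₂ , from₂) =
  decidable-stable (finite⇒≟ (DFA.finite D′) _ _) λ q′≢q″ →
    DFA.Minimized.inequivalent min′ q′≢q″
      ((λ {w} x → to₂ {w} (from₁ {w} x)) , (λ {w} x → to₁ {w} (from₂ {w} x)))

equivalent-δ : (D D′ : DFA Σ) → ∀ {q q′} c → Equivalent D D′ q q′ →
               Equivalent D D′ (DFA.δ D q c) (DFA.δ D′ q′ c)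
equivalent-δ D D′ c (to , from) = (λ {w} → to {c ∷ w}) , (λ {w} → from {c ∷ w})

-- Every extension `w ++ v` is still long, so both automata agree on it.
agree⇒equivalent : ∀ {N} (D D′ : DFA Σ) → AgreeFrom N D D′ → ∀ w → N ≤ length w →
  Equivalent D D′ (DFA.δ* D (DFA.start D) w) (DFA.δ* D′ (DFA.start D′) w)
agree⇒equivalent D D′ agree w N≤w =
  (λ {v} x → subst D′.Accepting (foldl-++ D′.δ D′.start w v)
    (Equivalence.to (agree (w ++ v) (long v))
      (subst D.Accepting (sym (foldl-++ D.δ D.start w v)) x))) ,
  (λ {v} x → subst D.Accepting (foldl-++ D.δ D.start w v)
    (Equivalence.from (agree (w ++ v) (long v))
      (subst D′.Accepting (sym (foldl-++ D′.δ D′.start w v)) x)))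
  where
  module D  = DFA D
  module D′ = DFA D′
  long : ∀ v → _ ≤ length (w ++ v)
  long v = ≤-trans N≤w (≤-trans (m≤m+n _ _) (≤-reflexive (sym (length-++ w))))

module Matching (finΣ : FiniteType Σ) {N : ℕ} (D D′ : DFA Σ)
                (min′ : DFA.Minimized D′) (agree : AgreeFrom N D D′) where
  private
    module D  = DFA D
    module D′ = DFA D′

  equivalent-infinite : ∀ {q q′} → Equivalent D D′ q q′ →
                        D.InInfinitePart q → D′.InInfinitePart q′
  -- Uniqueness sends every long word reaching `q` to `q′` in `D′`, so a list covering the words to
  -- `q′` also covers these.
  equivalent-infinite q≈q′ inf (ws , covers) = inf (finite-if-long finΣ D N (ws ,
    λ { {w} (N≤w , refl) →
      covers (equivalent-unique D D′ min′ (agree⇒equivalent D D′ agree w N≤w) q≈q′) }))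

  equivalentState : (q : D.InfinitePart) → ∃ (Equivalent D D′ (value q))
  equivalentState (q , [ inf ]) with longWordTo finΣ D N inf
  ... | w , N≤w , refl = D′.δ* D′.start w , agree⇒equivalent D D′ agree w N≤w

  match : D.InfinitePart → D′.InfinitePart
  match q@(_ , [ inf ]) =
    let q′ , q≈q′ = equivalentState q in q′ , [ equivalent-infinite q≈q′ inf ]

  match-equivalent : ∀ q → Equivalent D D′ (value q) (value (match q))
  match-equivalent q = proj₂ (equivalentState q)

  -- This makes `match` independent of the word found by the search, and reduces equations about it
  -- to equivalences.
  match-unique : ∀ q q′ → Equivalent D D′ (value q) (value q′) → match q ≡ q′
  match-unique q q′ q≈q′ =
    value-injective (equivalent-unique D D′ min′ (match-equivalent q) q≈q′)

mainTheorem1 : {Σ : Set} → FiniteType Σ → (D D′ : DFA Σ) →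
    DFA.Minimized D → DFA.Minimized D′ →
    DFA.language D ∼ DFA.language D′ → D ≅ᴵ D′
mainTheorem1 finΣ D D′ min min′ L∼L′ with ∼⇒agree D D′ L∼L′
... | N , agree = record
  { bijection           = mk⤖ (injective , strictlySurjective⇒surjective surjective)
  ; preserves-accepting = λ q →
      -- Equivalence at the empty word is agreement on acceptance.
      let to , from = F.match-equivalent q in mk⇔ (to {[]}) (from {[]})
  ; preserves-δ         = λ q c →
      F.match-unique (D.δᴵ q c) (D′.δᴵ (F.match q) c)
        (equivalent-δ D D′ c (F.match-equivalent q))
  }
  where
  module D  = DFA D
  module D′ = DFA D′
  module F = Matching finΣ D D′ min′ agree
  module G = Matching finΣ D′ D min (agree-sym D D′ agree)

  injective : ∀ {p q} → F.match p ≡ F.match q → p ≡ q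
  -- Both states are equivalent to the same state of `D′`, so minimality of `D` identifies them.
  injective {p} {q} eq = value-injective (equivalent-unique D′ D min
    (equivalent-sym D D′ (F.match-equivalent p))
    (subst (λ q′ → Equivalent D′ D (value q′) (value q)) (sym eq)
      (equivalent-sym D D′ (F.match-equivalent q))))

  surjective : ∀ q′ → ∃ λ q → F.match q ≡ q′
  -- The preimage comes from matching in the opposite direction.
  surjective q′ = G.match q′ ,
    F.match-unique (G.match q′) q′ (equivalent-sym D′ D (G.match-equivalent q′))
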